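{- For each effective programming system (eps) $\psi$, the following statements (a)–(c) are equivalent. (a) $\psi$ is minimal. (b) For each translation function $t$ into $\psi$, there exists a computably enumerable equivalence relation (ceer) that strongly ties $t$ into $\psi$. (c) For each translation function $t$ into $\psi$, there exists a ceer that weakly ties $t$ into $\psi$.
   Context: $\mathbb{N}=\{0,1,2,\dots\}$. Partial functions map $\mathbb{N}$ to $\mathbb{N}$ unless stated otherwise; equality of partial functions means same domain and same values. An effective programming system (eps) is a partial computable function $\psi:(p,x)\mapsto\psi_p(x)$ from $\mathbb{N}^2$ to $\mathbb{N}$ such that for each partial computable function $\zeta$ from $\mathbb{N}$ to $\mathbb{N}$ there exists $p$ with $\psi_p=\zeta$. Here $\psi_p$ denotes the partial function $x\mapsto\psi_p(x)$. For epses $\theta$ and $\psi$, $\theta\le\psi$ iff there exists a (total) computable function $t:\mathbb{N}\to\mathbb{N}$ such that $\theta_p=\psi_{t(p)}$ for each $p$; such a $t$ is said to witness $\theta\le\psi$. An eps $\psi$ is minimal iff, for each eps $\theta$, $\theta\le\psi$ implies $\psi\le\theta$. A function $t:\mathbb{N}\to\mathbb{N}$ is a translation function into an eps $\psi$ iff there exists an eps $\theta$ such that $t$ witnesses $\theta\le\psi$ (equivalently, $t$ is computable and $(p,x)\mapsto\psi_{t(p)}(x)$ is an eps). The program equivalence relation of an eps $\psi$ is $\mathrm{Equiv}(\psi)=\{(p,q)\in\mathbb{N}^2 : \psi_p=\psi_q\}$. A ceer is an equivalence relation on $\mathbb{N}$ that is computably enumerable as a set of pairs. Let $\psi$ be an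 eps, $t$ a translation function into $\psi$, and $R$ an equivalence relation on $\mathbb{N}$. $R$ strongly ties $t$ into $\psi$ iff (i) $R\subseteq\mathrm{Equiv}(\psi)$ and (ii) the range of $t$ intersects each of $R$'s equivalence classes. $R$ weakly ties $t$ into $\psi$ iff (i) $R\subseteq\mathrm{Equiv}(\psi)$ and (ii*) the range of $t$ intersects all but finitely many of $R$'s equivalence classes. -}

module Defs where

open import Data.Fin using (Fin)
open import Data.List.Relation.Unary.Any using (Any)
open import Data.Nat using (ℕ; zero; suc; _<_)
open import Data.Nat.Properties using (<-cmp)
open import Data.Product using (_×_; _,_; ∃-syntax)
open import Data.Sum using (_⊎_)
open import Data.Vec using (Vec; []; _∷_; lookup)
open import Data.Vec.Relation.Binary.Pointwise.Inductive using (Pointwise; []; _∷_)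
open import Function.Bundles using (_⇔_)
open import Level using (0ℓ)
open import Relation.Binary.Core using (Rel; _⇒_)
open import Relation.Binary.Definitions using (tri<; tri≈; tri>)
open import Relation.Binary.Structures using (IsEquivalence)
open import Relation.Binary.PropositionalEquality using (_≡_; refl; sym; trans; cong₂)
open import Relation.Nullary using (¬_)

-- A partial function ℕⁿ ⇀ ℕ is given by its graph, so that being defined
-- at an argument need not be decidable.
record PartialFunction (n : ℕ) : Set₁ where
  field
    Graph      : Vec ℕ n → ℕ → Set
    functional : ∀ {xs y z} → Graph xs y → Graph xs z → y ≡ z

open PartialFunction public

-- Same graph, i.e. same domain and same values.
infix 4 _≐_
_≐_ : ∀ {n} → PartialFunction n → PartialFunction n → Set
f ≐ g = ∀ xs y → Graph f xs y ⇔ Graph g xs y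

fromTotal : (ℕ → ℕ) → PartialFunction 1
fromTotal t = record
  { Graph      = λ { (x ∷ []) y → t x ≡ y }
  ; functional = λ { {_ ∷ []} p q → trans (sym p) q }
  }

-- The model of computation is Kleene's μ-recursive functions.
data Code : ℕ → Set where
  zeroᶜ : ∀ {n} → Code n
  sucᶜ  : Code 1
  proj  : ∀ {n} → Fin n → Code n
  comp  : ∀ {m n} → Code m → Vec (Code n) m → Code n
  prec  : ∀ {n} → Code n → Code (suc (suc n)) → Code (suc n)
  mu    : ∀ {n} → Code (suc n) → Code n

infix 4 _[_]⇓_
data _[_]⇓_ : ∀ {n} → Code n → Vec ℕ n → ℕ → Set where
  ⇓zero : ∀ {n} {xs : Vec ℕ n} → zeroᶜ [ xs ]⇓ 0
  ⇓suc  : ∀ {x} → sucᶜ [ x ∷ [] ]⇓ suc x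
  ⇓proj : ∀ {n} {xs : Vec ℕ n} (i : Fin n) → proj i [ xs ]⇓ lookup xs i
  ⇓comp : ∀ {m n} {f : Code m} {gs : Vec (Code n) m} {xs ys y} →
          Pointwise (λ g v → g [ xs ]⇓ v) gs ys →
          f [ ys ]⇓ y →
          comp f gs [ xs ]⇓ y
  ⇓prec-zero : ∀ {n} {g : Code n} {h xs y} →
          g [ xs ]⇓ y →
          prec g h [ 0 ∷ xs ]⇓ y
  ⇓prec-suc : ∀ {n} {g : Code n} {h xs k r y} →
          prec g h [ k ∷ xs ]⇓ r →
          h [ k ∷ r ∷ xs ]⇓ y →
          prec g h [ suc k ∷ xs ]⇓ y
  -- The least zero; f must be defined at every smaller argument.
  ⇓mu   : ∀ {n} {f : Code (suc n)} {xs z} →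
          (∀ i → i < z → ∃[ v ] f [ i ∷ xs ]⇓ suc v) →
          f [ z ∷ xs ]⇓ 0 →
          mu f [ xs ]⇓ z

mutual
  ⇓-functional : ∀ {n} {c : Code n} {xs y z} → c [ xs ]⇓ y → c [ xs ]⇓ z → y ≡ z
  ⇓-functional ⇓zero ⇓zero = refl
  ⇓-functional ⇓suc ⇓suc = refl
  ⇓-functional (⇓proj i) (⇓proj .i) = refl
  ⇓-functional (⇓comp ps p) (⇓comp qs q) with refl ← ⇓-functional* ps qs = ⇓-functional p q
  ⇓-functional (⇓prec-zero p) (⇓prec-zero q) = ⇓-functional p q
  ⇓-functional (⇓prec-suc p p′) (⇓prec-suc q q′) with refl ← ⇓-functional p q = ⇓-functional p′ q′
  ⇓-functional {y = y} {z} (⇓mu ps p) (⇓mu qs q) with <-cmp y z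
  ... | tri≈ _ y≡z _ = y≡z
  ... | tri< y<z _ _ with _ , q′ ← qs y y<z with () ← ⇓-functional p q′
  ... | tri> _ _ z<y with _ , p′ ← ps z z<y with () ← ⇓-functional p′ q

  ⇓-functional* : ∀ {m n} {gs : Vec (Code n) m} {xs ys zs} →
                  Pointwise (λ g v → g [ xs ]⇓ v) gs ys →
                  Pointwise (λ g v → g [ xs ]⇓ v) gs zs → ys ≡ zs
  ⇓-functional* [] [] = refl
  ⇓-functional* (p ∷ ps) (q ∷ qs) = cong₂ _∷_ (⇓-functional p q) (⇓-functional* ps qs)

⟦_⟧ : ∀ {n} → Code n → PartialFunction n
⟦ c ⟧ = record { Graph = c [_]⇓_ ; functional = ⇓-functional }

PartialComputable : ∀ {n} → PartialFunction n → Set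
PartialComputable f = ∃[ c ] f ≐ ⟦ c ⟧

Computable : (ℕ → ℕ) → Set
Computable t = PartialComputable (fromTotal t)

section : PartialFunction 2 → ℕ → PartialFunction 1
section ψ p = record
  { Graph      = λ xs → Graph ψ (p ∷ xs)
  ; functional = functional ψ
  }

record EPS : Set₁ where
  field
    function   : PartialFunction 2
    computable : PartialComputable function
    universal  : ∀ (ζ : PartialFunction 1) → PartialComputable ζ →
                 ∃[ p ] section function p ≐ ζ

infixl 8 _⟨_⟩
_⟨_⟩ : EPS → ℕ → PartialFunction 1
ψ ⟨ p ⟩ = section (EPS.function ψ) p

Witnesses : (ℕ → ℕ) → EPS → EPS → Set
Witnesses t θ ψ = Computable t × (∀ p → θ ⟨ p ⟩ ≐ ψ ⟨ t p ⟩)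

infix 4 _≼_
_≼_ : EPS → EPS → Set
θ ≼ ψ = ∃[ t ] Witnesses t θ ψ

Minimal : EPS → Set₁
Minimal ψ = ∀ (θ : EPS) → θ ≼ ψ → ψ ≼ θ

IsTranslationInto : (ℕ → ℕ) → EPS → Set₁
IsTranslationInto t ψ = ∃[ θ ] Witnesses t θ ψ

Equiv : EPS → Rel ℕ 0ℓ
Equiv ψ p q = ψ ⟨ p ⟩ ≐ ψ ⟨ q ⟩

-- Empty, or the range of a computable function n ↦ (f n , g n) into pairs.
ComputablyEnumerable : Rel ℕ 0ℓ → Set
ComputablyEnumerable R =
  (∀ x y → ¬ R x y) ⊎
  (∃[ f ] ∃[ g ] Computable f × Computable g ×
    (∀ x y → R x y ⇔ (∃[ n ] (f n ≡ x × g n ≡ y))))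

IsCeer : Rel ℕ 0ℓ → Set
IsCeer R = IsEquivalence R × ComputablyEnumerable R

-- The range of t intersects the R-class of p.
MeetsClass : (ℕ → ℕ) → Rel ℕ 0ℓ → ℕ → Set
MeetsClass t R p = ∃[ q ] R p (t q)

StronglyTies : Rel ℕ 0ℓ → (ℕ → ℕ) → EPS → Set
StronglyTies R t ψ = (R ⇒ Equiv ψ) × (∀ p → MeetsClass t R p)

-- "All but finitely many classes": every class outside a finite list, given
-- by representatives, meets the range of t.  The list may also contain
-- representatives of classes that do meet the range, or repetitions.
WeaklyTies : Rel ℕ 0ℓ → (ℕ → ℕ) → EPS → Set
WeaklyTies R t ψ =
  (R ⇒ Equiv ψ) × (∃[ exceptions ] (∀ p → Any (R p) exceptions ⊎ MeetsClass t R p))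

{-# OPTIONS --safe #-}
-- (a) ⇒ (b): if s witnesses ψ ≼ θ, then p and t (s p) are ψ-equivalent for
-- every p, so the orbit equivalence relation of t ∘ s ties t into ψ.
-- (c) ⇒ (a): adding the finitely many exceptional representatives to the range
-- of t makes every class meet the range; searching an enumeration of R for a
-- pair (p , t q) then translates p back into a θ-program.
module Submission where

open import Data.Fin using (Fin; zero; suc)
open import Data.List using (List; []; _∷_)
open import Data.List.Relation.Unary.Any using (Any; here; there)
open import Data.Nat using (ℕ; zero; suc; pred; _+_; _∸_; _≤_; _<_; s≤s)
open import Data.Nat.GeneralisedArithmetic using (fold; fold-+)
open import Data.Nat.Properties
open import Data.Product using (_×_; _,_; proj₁; proj₂; ∃-syntax)
open import Data.Sum using (_⊎_; inj₁; inj₂; [_,_]′)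
open import Data.Vec using (Vec; []; _∷_; lookup; tabulate)
open import Data.Vec.Properties using (tabulate∘lookup)
open import Data.Vec.Relation.Binary.Pointwise.Inductive using (Pointwise; []; _∷_; tabulate⁺)
open import Function using (_∘_; id)
open import Function.Bundles using (_⇔_; mk⇔; Equivalence)
open import Function.Construct.Composition using (_⇔-∘_)
open import Function.Construct.Identity using (⇔-id)
open import Function.Construct.Symmetry using (⇔-sym)
open import Level using (0ℓ)
open import Relation.Binary.Core using (Rel)
open import Relation.Binary.Structures using (IsEquivalence)
open import Relation.Binary.PropositionalEquality
open import Relation.Nullary using (contradiction)
open import Defs

open Equivalence using (to; from)

-- Total computable functions of several arguments

-- Only the derivations at the right values are stored; `⇓-functional` excludes all others, which is
-- how `toComputable` recovers equality of graphs.
TotalComputable : ∀ {n} → (Vec ℕ n → ℕ) → Set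
TotalComputable {n} f = ∃[ c ] (∀ xs → c [ xs ]⇓ f xs)

fromComputable : ∀ {t n} {a : Vec ℕ n → ℕ} →
                 Computable t → TotalComputable a → TotalComputable (t ∘ a)
fromComputable {t} {a = a} (c , t≐c) (d , d⇓) =
  comp c (d ∷ []) , λ xs → ⇓comp (d⇓ xs ∷ []) (to (t≐c (a xs ∷ []) (t (a xs))) refl)

toComputable : ∀ {t} → TotalComputable (λ xs → t (lookup xs zero)) → Computable t
toComputable (c , c⇓) = c , λ where
  (x ∷ []) y → mk⇔ (λ { refl → c⇓ (x ∷ []) }) (⇓-functional (c⇓ (x ∷ [])))

varᵗ : ∀ {n} (i : Fin n) → TotalComputable (λ xs → lookup xs i)
varᵗ i = proj i , λ _ → ⇓proj i

sucᵗ : ∀ {n} {a : Vec ℕ n → ℕ} → TotalComputable a → TotalComputable (suc ∘ a)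
sucᵗ (c , c⇓) = comp sucᶜ (c ∷ []) , λ xs → ⇓comp (c⇓ xs ∷ []) ⇓suc

constᵗ : ∀ {n} k → TotalComputable {n} (λ _ → k)
constᵗ zero    = zeroᶜ , λ _ → ⇓zero
constᵗ (suc k) = sucᵗ (constᵗ k)

-- Renaming of variables: a shift by two in `weaken₂`, the identity in `primRec`, where the
-- parameters are passed on unchanged.
projections : ∀ {m n} (ρ : Fin m → Fin n) {xs : Vec ℕ n} {ys : Vec ℕ m} →
              (∀ i → lookup xs (ρ i) ≡ lookup ys i) →
              Pointwise (λ g v → g [ xs ]⇓ v) (tabulate (proj ∘ ρ)) ys
projections ρ {xs} {ys} eq =
  subst (Pointwise _ _) (tabulate∘lookup ys)
    (tabulate⁺ (λ i → subst (proj (ρ i) [ xs ]⇓_) (eq i) (⇓proj (ρ i))))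

weaken₂ : ∀ {n} {a : Vec ℕ n → ℕ} → TotalComputable a →
          TotalComputable {suc (suc n)} (λ { (_ ∷ _ ∷ xs) → a xs })
weaken₂ (c , c⇓) = comp c (tabulate (λ i → proj (suc (suc i)))) , λ where
  (_ ∷ _ ∷ xs) → ⇓comp (projections (λ i → suc (suc i)) (λ _ → refl)) (c⇓ xs)

-- `F` may be defined in any way, as long as it satisfies the recursion equation `step`. The
-- recursion argument is already composed with `a`, so that the closure lemmas chain without
-- explicit substitution.
primRec : ∀ {n} (F : ℕ → Vec ℕ n → ℕ) {h : Vec ℕ (suc (suc n)) → ℕ} {a : Vec ℕ n → ℕ} →
          TotalComputable (F 0) → TotalComputable h →
          (∀ k xs → h (k ∷ F k xs ∷ xs) ≡ F (suc k) xs) →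
          TotalComputable a → TotalComputable (λ xs → F (a xs) xs)
primRec F {a = a} (g , g⇓) (h , h⇓) step (c , c⇓) =
  comp (prec g h) (c ∷ tabulate proj) ,
  λ xs → ⇓comp (c⇓ xs ∷ projections id (λ _ → refl)) (rec⇓ (a xs) xs)
  where
  rec⇓ : ∀ k xs → prec g h [ k ∷ xs ]⇓ F k xs
  rec⇓ zero    xs = ⇓prec-zero (g⇓ xs)
  rec⇓ (suc k) xs =
    ⇓prec-suc (rec⇓ k xs) (subst (h [ _ ]⇓_) (step k xs) (h⇓ (k ∷ F k xs ∷ xs)))

-- Recursion on a known zero, shifting `f` by one each time. Smaller values come back as successors,
-- the form that `⇓mu` asks for.
leastZero : (f : ℕ → ℕ) → ∀ z → f z ≡ 0 →
            ∃[ m ] (f m ≡ 0 × (∀ i → i < m → ∃[ v ] f i ≡ suc v))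
leastZero f z fz≡0 with f 0 in f0≡
... | zero = 0 , f0≡ , λ _ ()
leastZero f zero    fz≡0 | suc v = contradiction (trans (sym f0≡) fz≡0) λ ()
leastZero f (suc z) fz≡0 | suc v with leastZero (f ∘ suc) z fz≡0
... | m , fm≡0 , below = suc m , fm≡0 , λ where
  zero    _         → v , f0≡
  (suc i) (s≤s i<m) → below i i<m

-- The zero given by `hit` only bounds the search, so it may depend on `xs` in any way; the value
-- computed by `mu` is the least zero.
search : ∀ {n} {f : Vec ℕ (suc n) → ℕ} → TotalComputable f →
         (∀ xs → ∃[ z ] f (z ∷ xs) ≡ 0) →
         ∃[ s ] (TotalComputable s × (∀ xs → f (s xs ∷ xs) ≡ 0))
search {f = f} (c , c⇓) hit =
  (λ xs → proj₁ (least xs)) ,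
  (mu c , λ xs → let m , fm≡0 , below = least xs in
    ⇓mu (λ i i<m → let v , fi≡ = below i i<m in
           v , subst (c [ i ∷ xs ]⇓_) fi≡ (c⇓ (i ∷ xs)))
        (subst (c [ m ∷ xs ]⇓_) fm≡0 (c⇓ (m ∷ xs)))) ,
  (λ xs → proj₁ (proj₂ (least xs)))
  where
  least = λ xs → leastZero (λ z → f (z ∷ xs)) (proj₁ (hit xs)) (proj₂ (hit xs))

predᵗ : ∀ {n} {a : Vec ℕ n → ℕ} → TotalComputable a → TotalComputable (pred ∘ a)
predᵗ = primRec (λ k _ → pred k) (constᵗ 0) (varᵗ zero) (λ _ _ → refl)

module _ {n} {a b : Vec ℕ n → ℕ} where

  infixl 6 _+ᵗ_ _∸ᵗ_

  _+ᵗ_ : TotalComputable a → TotalComputable b → TotalComputable (λ xs → a xs + b xs)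
  a′ +ᵗ b′ =
    primRec (λ k xs → k + b xs) b′ (sucᵗ (varᵗ (suc zero))) (λ _ _ → refl) a′

  _∸ᵗ_ : TotalComputable a → TotalComputable b → TotalComputable (λ xs → a xs ∸ b xs)
  a′ ∸ᵗ b′ =
    primRec (λ k xs → a xs ∸ k) a′ (predᵗ (varᵗ (suc zero)))
            (λ k xs → pred[m∸n]≡m∸[1+n] (a xs) k) b′

foldᵗ : ∀ {n} {f : ℕ → ℕ} {a b : Vec ℕ n → ℕ} → Computable f →
        TotalComputable a → TotalComputable b → TotalComputable (λ xs → fold (a xs) f (b xs))
foldᵗ {f = f} {a} f′ a′ =
  primRec (λ k xs → fold (a xs) f k) a′ (fromComputable f′ (varᵗ (suc zero))) (λ _ _ → refl)

ifZero : ℕ → ℕ → ℕ → ℕ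
ifZero zero    x y = x
ifZero (suc _) x y = y

ifZeroᵗ : ∀ {n} {a b c : Vec ℕ n → ℕ} →
          TotalComputable a → TotalComputable b → TotalComputable c →
          TotalComputable (λ xs → ifZero (a xs) (b xs) (c xs))
ifZeroᵗ {b = b} {c} a′ b′ c′ =
  -- Case distinction as recursion: the base is `b`, and the step returns `c` whatever the counter
  -- and the previous value are.
  primRec (λ k xs → ifZero k (b xs) (c xs)) b′ (weaken₂ c′) (λ _ _ → refl) a′

-- The absolute difference, which turns equality into a zero test for `ifZero` and `search`.
dist : ℕ → ℕ → ℕ
dist m n = (m ∸ n) + (n ∸ m)

distᵗ : ∀ {n} {a b : Vec ℕ n → ℕ} →
        TotalComputable a → TotalComputable b → TotalComputable (λ xs → dist (a xs) (b xs))
distᵗ a′ b′ = (a′ ∸ᵗ b′) +ᵗ (b′ ∸ᵗ a′)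

dist≡0⇒≡ : ∀ {m n} → dist m n ≡ 0 → m ≡ n
dist≡0⇒≡ {m} {n} eq =
  ≤-antisym (m∸n≡0⇒m≤n (m+n≡0⇒m≡0 (m ∸ n) eq)) (m∸n≡0⇒m≤n (m+n≡0⇒n≡0 (m ∸ n) eq))

dist-refl : ∀ n → dist n n ≡ 0
dist-refl n = cong₂ _+_ (n∸n≡0 n) (n∸n≡0 n)

-- Computable unpairing

triangle : ℕ → ℕ
triangle zero    = 0
triangle (suc k) = suc (triangle k + k)

-- Cantor's enumeration visits (0 , w), …, (w , 0) at triangle w, …, triangle w + w;
-- the row of z is this w, and it grows exactly when z reaches the next triangle.
row : ℕ → ℕ
row zero    = 0
row (suc z) = row z + (1 ∸ (triangle (suc (row z)) ∸ suc z))

-- Induction along the enumeration. At the end of diagonal `w` the inner difference in `row` is 0,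
-- so the row grows by 1; stepping from place `a < w` to `suc a` that difference is `w ∸ a`, which
-- is positive, so nothing is added.
row-triangle : ∀ w a → a ≤ w → row (a + triangle w) ≡ w
row-triangle zero zero _ = refl
row-triangle (suc w) zero _
  rewrite +-comm (triangle w) w | row-triangle w w ≤-refl | +-comm (triangle w) w
        | n∸n≡0 (w + triangle w) = +-comm w 1
row-triangle w (suc a) a<w
  rewrite row-triangle w a (<⇒≤ a<w) | +-comm a (triangle w)
        | [m+n]∸[m+o]≡n∸o (triangle w) w a
        | m≤n⇒m∸n≡0 {1} (m<n⇒0<n∸m a<w) = +-identityʳ w

fst snd : ℕ → ℕ
fst z = z ∸ triangle (row z)
snd z = row z ∸ fst z

unpair-surjective : ∀ a b → ∃[ z ] (fst z ≡ a × snd z ≡ b)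
unpair-surjective a b = z , fst≡ , snd≡
  where
  z : ℕ
  -- The Cantor code: place `a` on diagonal `a + b`.
  z = a + triangle (a + b)
  row≡ : row z ≡ a + b
  row≡ = row-triangle (a + b) a (m≤m+n a b)
  fst≡ : fst z ≡ a
  fst≡ = trans (cong (λ w → z ∸ triangle w) row≡) (m+n∸n≡m a (triangle (a + b)))
  snd≡ : snd z ≡ b
  snd≡ = trans (cong₂ _∸_ row≡ fst≡) (m+n∸m≡n a b)

triangleᵗ : ∀ {n} {a : Vec ℕ n → ℕ} → TotalComputable a → TotalComputable (triangle ∘ a)
triangleᵗ =
  primRec (λ k _ → triangle k) (constᵗ 0) (sucᵗ (varᵗ (suc zero) +ᵗ varᵗ zero)) (λ _ _ → refl)

module _ {n} {a : Vec ℕ n → ℕ} (a′ : TotalComputable a) where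

  rowᵗ : TotalComputable (row ∘ a)
  rowᵗ = primRec (λ k _ → row k) (constᵗ 0)
    (varᵗ (suc zero) +ᵗ (constᵗ 1 ∸ᵗ (triangleᵗ (sucᵗ (varᵗ (suc zero))) ∸ᵗ sucᵗ (varᵗ zero))))
    (λ _ _ → refl) a′

  fstᵗ : TotalComputable (fst ∘ a)
  fstᵗ = a′ ∸ᵗ triangleᵗ rowᵗ

  sndᵗ : TotalComputable (snd ∘ a)
  sndᵗ = rowᵗ ∸ᵗ fstᵗ

-- Equality of partial functions and computability of compositions and sections

≐-refl : ∀ {n} (f : PartialFunction n) → f ≐ f
≐-refl _ _ _ = ⇔-id _

≐-sym : ∀ {n} (f g : PartialFunction n) → f ≐ g → g ≐ f
≐-sym _ _ f≐g xs y = ⇔-sym (f≐g xs y)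

≐-trans : ∀ {n} (f g h : PartialFunction n) → f ≐ g → g ≐ h → f ≐ h
≐-trans _ _ _ f≐g g≐h xs y = g≐h xs y ⇔-∘ f≐g xs y

∘-computable : ∀ {f g} → Computable f → Computable g → Computable (f ∘ g)
∘-computable f′ g′ = toComputable (fromComputable f′ (fromComputable g′ (varᵗ zero)))

-- The program `p` is hard-wired as a constant code. Universality of another eps then applies to
-- `ψ ⟨ p ⟩`.
⟨⟩-computable : ∀ (ψ : EPS) p → PartialComputable (ψ ⟨ p ⟩)
⟨⟩-computable ψ p = comp c (k ∷ proj zero ∷ []) , λ where
    (x ∷ []) y → mk⇔
      (λ ψpx → ⇓comp (k⇓ (x ∷ []) ∷ ⇓proj zero ∷ []) (to (ψ≐c (p ∷ x ∷ []) y) ψpx))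
      (λ { (⇓comp (k⇓p ∷ ⇓proj zero ∷ []) c⇓y) →
             from (ψ≐c (p ∷ x ∷ []) y)
               (subst (λ v → c [ v ∷ x ∷ [] ]⇓ y) (⇓-functional k⇓p (k⇓ (x ∷ []))) c⇓y) })
  where
  c = proj₁ (EPS.computable ψ)
  ψ≐c = proj₂ (EPS.computable ψ)
  k = proj₁ (constᵗ {1} p)
  k⇓ = proj₂ (constᵗ {1} p)

-- The orbit equivalence relation of a computable function

-- The least equivalence relation that relates every `p` to `f p`. As merging of forward orbits it
-- needs only two iteration counts as a certificate, so it can be enumerated.
Orbit : (ℕ → ℕ) → Rel ℕ 0ℓ
Orbit f p q = ∃[ m ] ∃[ k ] fold p f m ≡ fold q f k

Orbit-isEquivalence : ∀ f → IsEquivalence (Orbit f)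
Orbit-isEquivalence f = record
  { refl  = 0 , 0 , refl
  ; sym   = λ (m , k , eq) → k , m , sym eq
  -- Both orbits are continued until they meet at iterate `k + m′` of `q`: the first by `m′` steps,
  -- the second by `k`.
  ; trans = λ {p} {q} {r} (m , k , eq) (m′ , k′ , eq′) → m′ + m , k + k′ , (begin
      fold p f (m′ + m)         ≡⟨ fold-+ p f m′ ⟩
      fold (fold p f m) f m′    ≡⟨ cong (λ x → fold x f m′) eq ⟩
      fold (fold q f k) f m′    ≡⟨ fold-+ q f m′ ⟨
      fold q f (m′ + k)         ≡⟨ cong (fold q f) (+-comm m′ k) ⟩
      fold q f (k + m′)         ≡⟨ fold-+ q f k ⟩
      fold (fold q f m′) f k    ≡⟨ cong (λ x → fold x f k) eq′ ⟩
      fold (fold r f k′) f k    ≡⟨ fold-+ r f k ⟨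
      fold r f (k + k′)         ∎)
  }
  where open ≡-Reasoning

-- A number z codes p, q, m, k; it enumerates (p , q) if fᵐ p = fᵏ q, and the
-- harmless pair (p , p) otherwise.
Orbit-enumerable : ∀ {f} → Computable f → ComputablyEnumerable (Orbit f)
Orbit-enumerable {f} f′ = inj₂
  (P , Q , toComputable P′ , toComputable Q′ , λ p q → mk⇔ enumerated (sound p q))
  where
  P D Q : ℕ → ℕ
  P z = fst (fst z)
  D z = dist (fold (P z) f (fst (snd z))) (fold (snd (fst z)) f (snd (snd z)))
  Q z = ifZero (D z) (snd (fst z)) (P z)

  z′ : TotalComputable {1} (λ xs → lookup xs zero)
  z′ = varᵗ zero
  P′ : TotalComputable {1} (λ xs → P (lookup xs zero))
  P′ = fstᵗ (fstᵗ z′)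
  Q′ : TotalComputable {1} (λ xs → Q (lookup xs zero))
  Q′ = ifZeroᵗ (distᵗ (foldᵗ f′ P′ (fstᵗ (sndᵗ z′))) (foldᵗ f′ (sndᵗ (fstᵗ z′)) (sndᵗ (sndᵗ z′))))
               (sndᵗ (fstᵗ z′)) P′

  enumerated : ∀ {p q} → Orbit f p q → ∃[ z ] (P z ≡ p × Q z ≡ q)
  enumerated {p} {q} (m , k , eq)
    with x , refl , refl ← unpair-surjective p q
    with y , refl , refl ← unpair-surjective m k
    with z , refl , refl ← unpair-surjective x y
    = z , refl , cong (λ d → ifZero d (snd (fst z)) (P z)) D≡0
    where
    D≡0 : D z ≡ 0
    D≡0 = trans (cong (λ v → dist v N) eq) (dist-refl N)
      where
      N : ℕ
      N = fold (snd (fst z)) f (snd (snd z))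

  sound : ∀ p q → ∃[ z ] (P z ≡ p × Q z ≡ q) → Orbit f p q
  sound _ _ (z , refl , refl) with D z in D≡
  ... | zero  = fst (snd z) , snd (snd z) , dist≡0⇒≡ D≡
  ... | suc _ = 0 , 0 , refl

-- Tying and minimality

Ties : (Rel ℕ 0ℓ → (ℕ → ℕ) → EPS → Set) → EPS → Set₁
Ties T ψ = ∀ t → IsTranslationInto t ψ → ∃[ R ] (IsCeer R × T R t ψ)

minimal⇒strong : ∀ ψ → Minimal ψ → Ties StronglyTies ψ
minimal⇒strong ψ minimal t (θ , t′ , θ≐ψt) with minimal θ (t , t′ , θ≐ψt)
... | s , s′ , ψ≐θs =
  Orbit f , (Orbit-isEquivalence f , Orbit-enumerable (∘-computable t′ s′)) ,
  -- One step of `f` from `p` lands on `t (s p)` itself.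
  Orbit⇒Equiv , λ p → s p , 1 , 0 , refl
  where
  f : ℕ → ℕ
  f = t ∘ s
  ψ≐ψf : ∀ p m → ψ ⟨ p ⟩ ≐ ψ ⟨ fold p f m ⟩
  ψ≐ψf p zero    = ≐-refl (ψ ⟨ p ⟩)
  ψ≐ψf p (suc m) =
    ≐-trans (ψ ⟨ p ⟩) (ψ ⟨ q ⟩) (ψ ⟨ f q ⟩) (ψ≐ψf p m)
      (≐-trans (ψ ⟨ q ⟩) (θ ⟨ s q ⟩) (ψ ⟨ f q ⟩) (ψ≐θs q) (θ≐ψt (s q)))
    where
    q : ℕ
    q = fold p f m
  Orbit⇒Equiv : ∀ {p q} → Orbit f p q → Equiv ψ p q
  Orbit⇒Equiv {p} {q} (m , k , eq) =
    ≐-trans (ψ ⟨ p ⟩) (ψ ⟨ fold q f k ⟩) (ψ ⟨ q ⟩)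
      (subst (λ r → ψ ⟨ p ⟩ ≐ ψ ⟨ r ⟩) eq (ψ≐ψf p m))
      (≐-sym (ψ ⟨ q ⟩) (ψ ⟨ fold q f k ⟩) (ψ≐ψf q k))

strong⇒weak : ∀ ψ → Ties StronglyTies ψ → Ties WeaklyTies ψ
strong⇒weak ψ strong t translation with strong t translation
... | R , ceer , R⇒Equiv , meets = R , ceer , R⇒Equiv , [] , inj₂ ∘ meets

prepend : ℕ → (ℕ → ℕ) → ℕ → ℕ
prepend e t zero    = e
prepend e t (suc j) = t j

prepend-computable : ∀ e {t} → Computable t → Computable (prepend e t)
prepend-computable e {t} t′ = toComputable
  (primRec (λ k _ → prepend e t k) (constᵗ e) (fromComputable t′ (varᵗ zero)) (λ _ _ → refl)
           (varᵗ zero))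

module _ {ψ θ : EPS} {R : Rel ℕ 0ℓ} (ceer : IsCeer R)
         (R⇒Equiv : ∀ {p q} → R p q → Equiv ψ p q) where

  -- `u` records a `θ`-program for each `ψ`-program `t j`. It is carried along because prepending
  -- exceptional programs to `t` shifts the indices, after which `j` need no longer be such a
  -- `θ`-program.
  meets⇒≼ : ∀ {t u} → Computable t → Computable u → (∀ j → ψ ⟨ t j ⟩ ≐ θ ⟨ u j ⟩) →
            (∀ p → MeetsClass t R p) → ψ ≼ θ
  meets⇒≼ t′ u′ ψt≐θu meets with proj₂ ceer
  -- By reflexivity `R` contains `(0 , 0)`.
  ... | inj₁ empty = contradiction (IsEquivalence.refl (proj₁ ceer)) (empty 0 0)
  meets⇒≼ {t} {u} t′ u′ ψt≐θu meets | inj₂ (f , g , f′ , g′ , enumerates) =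
    r , toComputable (fromComputable u′ (sndᵗ s′)) , ψ≐θr
    where
    -- z codes a position i in the enumeration and an index j into the range of t.
    test : Vec ℕ 2 → ℕ
    test (z ∷ p ∷ []) = dist (f (fst z)) p + dist (g (fst z)) (t (snd z))
    test′ : TotalComputable test
    test′ = c , λ { (z ∷ p ∷ []) → c⇓ (z ∷ p ∷ []) }
      where
      z′ : TotalComputable {2} (λ xs → lookup xs zero)
      z′ = varᵗ zero
      body = distᵗ (fromComputable f′ (fstᵗ z′)) (varᵗ (suc zero)) +ᵗ
             distᵗ (fromComputable g′ (fstᵗ z′)) (fromComputable t′ (sndᵗ z′))
      c = proj₁ body
      c⇓ = proj₂ body
    hit : ∀ xs → ∃[ z ] test (z ∷ xs) ≡ 0
    hit (p ∷ []) with j , Rptj ← meets p with i , refl , gi≡ ← to (enumerates p (t j)) Rptj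
      with z , refl , refl ← unpair-surjective i j
      = z , cong₂ _+_ (dist-refl (f (fst z)))
                      (trans (cong (λ v → dist v (t (snd z))) gi≡) (dist-refl (t (snd z))))
    found = search test′ hit
    s : ℕ → ℕ
    s p = proj₁ found (p ∷ [])
    s′ : TotalComputable {1} (λ xs → s (lookup xs zero))
    s′ = proj₁ (proj₁ (proj₂ found)) , λ { (p ∷ []) → proj₂ (proj₁ (proj₂ found)) (p ∷ []) }
    r : ℕ → ℕ
    r p = u (snd (s p))
    ψ≐θr : ∀ p → ψ ⟨ p ⟩ ≐ θ ⟨ r p ⟩
    ψ≐θr p = ≐-trans (ψ ⟨ p ⟩) (ψ ⟨ t j ⟩) (θ ⟨ u j ⟩) (R⇒Equiv Rptj) (ψt≐θu j)
      where
      i = fst (s p)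
      j = snd (s p)
      zero-test : test (s p ∷ p ∷ []) ≡ 0
      zero-test = proj₂ (proj₂ found) (p ∷ [])
      Rptj : R p (t j)
      Rptj = from (enumerates p (t j))
        (i , dist≡0⇒≡ (m+n≡0⇒m≡0 (dist (f i) p) zero-test)
           , dist≡0⇒≡ (m+n≡0⇒n≡0 (dist (f i) p) zero-test))

  -- Induction on the list: universality of `θ` gives a program `q` for `ψ ⟨ e ⟩`, and `e` and `q`
  -- are prepended to `t` and `u`. Each step adds one constant, so both functions stay computable.
  almostMeets⇒≼ : ∀ exceptions {t u} → Computable t → Computable u →
                  (∀ j → ψ ⟨ t j ⟩ ≐ θ ⟨ u j ⟩) →
                  (∀ p → Any (R p) exceptions ⊎ MeetsClass t R p) → ψ ≼ θ
  almostMeets⇒≼ [] t′ u′ ψt≐θu meets =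
    meets⇒≼ t′ u′ ψt≐θu λ p → [ (λ ()) , id ]′ (meets p)
  almostMeets⇒≼ (e ∷ es) {t} {u} t′ u′ ψt≐θu meets
    with q , θq≐ψe ← EPS.universal θ (ψ ⟨ e ⟩) (⟨⟩-computable ψ e) =
    almostMeets⇒≼ es (prepend-computable e t′) (prepend-computable q u′)
      (λ { zero → ≐-sym (θ ⟨ q ⟩) (ψ ⟨ e ⟩) θq≐ψe ; (suc j) → ψt≐θu j })
      λ p → shift p (meets p)
    where
    shift : ∀ p → Any (R p) (e ∷ es) ⊎ MeetsClass t R p →
            Any (R p) es ⊎ MeetsClass (prepend e t) R p
    shift p (inj₁ (here Rpe))  = inj₂ (0 , Rpe)
    shift p (inj₁ (there any)) = inj₁ any
    shift p (inj₂ (j , Rptj))  = inj₂ (suc j , Rptj)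

weak⇒minimal : ∀ ψ → Ties WeaklyTies ψ → Minimal ψ
weak⇒minimal ψ weak θ (t , t′ , θ≐ψt) with weak t (θ , t′ , θ≐ψt)
... | R , ceer , R⇒Equiv , exceptions , meets =
  -- The induction starts with `u` the identity, since `t j` is the translation of the `θ`-program
  -- `j`.
  almostMeets⇒≼ {ψ} {θ} ceer R⇒Equiv exceptions t′ (toComputable (varᵗ zero))
    (λ j → ≐-sym (θ ⟨ j ⟩) (ψ ⟨ t j ⟩) (θ≐ψt j)) meets

theorem6 : ∀ (ψ : EPS) →
    (Minimal ψ ⇔ (∀ (t : ℕ → ℕ) → IsTranslationInto t ψ → ∃[ R ] (IsCeer R × StronglyTies R t ψ)))
    × (Minimal ψ ⇔ (∀ (t : ℕ → ℕ) → IsTranslationInto t ψ → ∃[ R ] (IsCeer R × WeaklyTies R t ψ)))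
theorem6 ψ =
  mk⇔ (minimal⇒strong ψ) (weak⇒minimal ψ ∘ strong⇒weak ψ) ,
  mk⇔ (strong⇒weak ψ ∘ minimal⇒strong ψ) (weak⇒minimal ψ)
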